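{- For MLAPD on a path of depth $D$ (the tree $\mathcal{T}$ is a path graph with $D$ nodes whose root $r$ is an endpoint), the online algorithm \textsc{Double} is $(4-2^{ -D})$-competitive.
   Context: MLAPD: an instance is a rooted tree $\mathcal{T}$ with root $r$ and positive node costs $c(v)>0$, together with a set $\mathcal{R}$ of requests $\rho=(v,a,d)$ (node, arrival time, deadline $d\ge a$; deadlines distinct). A service $(S,t)$ is a subtree $S\ni r$ transmitted at time $t$, costing $c(S)=\sum_{u\in S}c(u)$; it satisfies $(v,a,d)$ if $v\in S$ and $a\le t\le d$. A feasible schedule satisfies every request; its cost is the sum of service costs. Online: requests revealed at arrival. $c$-competitive: cost at most $c$ times optimal on every instance. For request $\rho$ at $v$, $P_\rho$ is the set of nodes on the $r$–$v$ path; for a node set $S$, $c(r\to\gamma\mid S)=c(P_\gamma\setminus S)$. A request is pending at time $t$ if it has arrived by $t$ and was not satisfied by earlier transmissions. \textsc{Double}: when a pending request $\rho$ reaches its deadline $d_\rho$, set $S=P_\rho$; then repeat: if no pending request is unsatisfied by $S$, stop; otherwise let $\gamma$ be the pending request with earliest deadline not satisfied by $S$; if $c(S)+c(r\to\gamma\mid S)>2c(P_\rho)$ stop, else set $S\gets S\cup P_\gamma$. Finally transmit $(S,d_\rho)$. -}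

module Defs where

open import Algebra.Bundles using (CommutativeRing; Semiring)
open import Data.Bool.Base using (if_then_else_)
open import Data.Fin.Base using (Fin; toℕ)
open import Data.Fin.Subset using (Subset; _∈_; _∪_; _─_; ⋃; ⁅_⁆)
open import Data.Fin.Subset.Properties using (_∈?_)
open import Data.List.Base as List using (List; []; _∷_; filter; foldr; head; map)
open import Data.List.Relation.Unary.All using (All)
open import Data.List.Relation.Unary.AllPairs using (AllPairs)
open import Data.List.Relation.Unary.Any using (Any; any?)
import Data.List.Sort as Sort
open import Data.Maybe.Base as Maybe using (Maybe; just; nothing)
open import Data.Nat.Base using (ℕ; suc)
open import Data.Nat.GeneralisedArithmetic using (iterate)
open import Data.Product.Base using (_×_)
open import Function.Bundles using (_↔_; Inverse)
open import Level using (Level; _⊔_) renaming (suc to lsuc)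
open import Relation.Binary.Bundles using (DecTotalOrder)
open import Relation.Binary.Core using (Rel)
open import Relation.Binary.Structures using (IsDecTotalOrder)
import Relation.Binary.Construct.NonStrictToStrict as ToStrict
import Relation.Binary.Construct.On as On
open import Relation.Binary.PropositionalEquality.Core using (_≡_)
open import Relation.Nullary.Decidable.Core using (Dec; does; _×-dec_; ¬?)
open import Relation.Nullary.Negation.Core using (¬_)

-- Times and costs live in an arbitrary ordered field with decidable order,
-- standing in for ℝ; ℚ is another model.
record OrderedField c ℓ₁ ℓ₂ : Set (lsuc (c ⊔ ℓ₁ ⊔ ℓ₂)) where
  infix 4 _≤_
  infix 9 _⁻¹
  field
    commutativeRing : CommutativeRing c ℓ₁
  open CommutativeRing commutativeRing public
  field
    _≤_             : Rel Carrier ℓ₂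
    isDecTotalOrder : IsDecTotalOrder _≈_ _≤_
    +-monoˡ-≤       : ∀ {x y} z → x ≤ y → x + z ≤ y + z
    *-nonNeg        : ∀ {x y} → 0# ≤ x → 0# ≤ y → 0# ≤ x * y
    0≉1             : ¬ 0# ≈ 1#
    -- Total for convenience: the value at zero is unconstrained.
    _⁻¹             : Carrier → Carrier
    ⁻¹-inverseʳ     : ∀ x → ¬ x ≈ 0# → x * x ⁻¹ ≈ 1#

  decTotalOrder : DecTotalOrder c ℓ₁ ℓ₂
  decTotalOrder = record { isDecTotalOrder = isDecTotalOrder }

  open IsDecTotalOrder isDecTotalOrder public using (_≟_; _≤?_)
  open ToStrict _≈_ _≤_ public using (_<_)
  open import Algebra.Definitions.RawSemiring
    (Semiring.rawSemiring semiring) public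
    using (_^_; sum) renaming (_×_ to _×ⁿ_)

  fromℕ : ℕ → Carrier
  fromℕ k = k ×ⁿ 1#

-- A rooted tree on the nodes Fin n. The edges are {v , parent v} for v ≢ root;
-- the root is its own parent by convention.
record RootedTree (n : ℕ) : Set where
  field
    root         : Fin n
    parent       : Fin n → Fin n
    parent-root  : parent root ≡ root
    steps        : Fin n → ℕ
    reaches-root : ∀ v → iterate parent v (steps v) ≡ root

  -- The node set of the root–v path: v, parent v, …, root.
  pathTo : Fin n → Subset n
  pathTo v = ⋃ (map ⁅_⁆ (List.iterate parent v (suc (steps v))))

  -- Connected node sets containing the root, i.e. those closed under parents.
  record IsSubtree (S : Subset n) : Set where
    field
      root∈         : root ∈ S
      parent-closed : ∀ {v} → v ∈ S → parent v ∈ S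

-- The nodes can be listed as root = v₀, v₁, …, so that the tree edges are exactly
-- the consecutive pairs.
record IsPath {n : ℕ} (T : RootedTree n) : Set where
  open RootedTree T
  field
    enumeration : Fin n ↔ Fin n
  open Inverse enumeration using (to)
  field
    starts-at-root : ∀ i → toℕ i ≡ 0 → to i ≡ root
    consecutive    : ∀ i j → toℕ j ≡ suc (toℕ i) → parent (to j) ≡ to i

module MLAPD {c ℓ₁ ℓ₂ : Level} (K : OrderedField c ℓ₁ ℓ₂) where
  open OrderedField K

  record Network (n : ℕ) : Set (c ⊔ ℓ₁ ⊔ ℓ₂) where
    field
      tree     : RootedTree n
      cost     : Fin n → Carrier
      cost-pos : ∀ v → 0# < cost v

    open RootedTree tree public

    costOf : Subset n → Carrier
    costOf S = sum (λ u → if does (u ∈? S) then cost u else 0#)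

    -- c(r → v ∣ S)
    costTo_given_ : Fin n → Subset n → Carrier
    costTo v given S = costOf (pathTo v ─ S)

  record Request (n : ℕ) : Set (c ⊔ ℓ₂) where
    field
      node             : Fin n
      arrival          : Carrier
      deadline         : Carrier
      arrival≤deadline : arrival ≤ deadline
  open Request public

  record Service (n : ℕ) : Set c where
    constructor _at_
    field
      nodes : Subset n
      time  : Carrier
  open Service public

  Schedule : ℕ → Set c
  Schedule n = List (Service n)

  record Instance (n : ℕ) : Set (c ⊔ ℓ₁ ⊔ ℓ₂) where
    field
      network            : Network n
      requests           : List (Request n)
      distinct-deadlines : AllPairs (λ ρ σ → ¬ deadline ρ ≈ deadline σ) requests

    open Network network public

  module _ {n : ℕ} where

    Satisfies : Service n → Request n → Set ℓ₂
    Satisfies s ρ = (node ρ ∈ nodes s) × (arrival ρ ≤ time s) × (time s ≤ deadline ρ)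

    satisfies? : ∀ s ρ → Dec (Satisfies s ρ)
    satisfies? s ρ =
      (node ρ ∈? nodes s) ×-dec (arrival ρ ≤? time s) ×-dec (time s ≤? deadline ρ)

    SatisfiedBy : Schedule n → Request n → Set (c ⊔ ℓ₂)
    SatisfiedBy σ ρ = Any (λ s → Satisfies s ρ) σ

    Pending : Carrier → Schedule n → Request n → Set (c ⊔ ℓ₂)
    Pending t past ρ = (arrival ρ ≤ t) × ¬ SatisfiedBy past ρ

    pending? : ∀ t past ρ → Dec (Pending t past ρ)
    pending? t past ρ =
      (arrival ρ ≤? t) ×-dec ¬? (any? (λ s → satisfies? s ρ) past)

    -- Services need not be listed chronologically.
    record Feasible (I : Instance n) (σ : Schedule n) : Set (c ⊔ ℓ₂) where
      open Instance I
      field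
        subtrees  : All (λ s → IsSubtree (nodes s)) σ
        satisfied : All (SatisfiedBy σ) requests

    scheduleCost : Network n → Schedule n → Carrier
    scheduleCost N = foldr (λ s total → Network.costOf N (nodes s) + total) 0#

    sortByDeadline : List (Request n) → List (Request n)
    sortByDeadline = Sort.sort (On.decTotalOrder decTotalOrder deadline)

  -- An online algorithm acting at deadlines: given the current time, the
  -- requests that have arrived so far and its own earlier services, it may
  -- transmit a node set.
  OnlineAlgorithm : ℕ → Set (c ⊔ ℓ₁ ⊔ ℓ₂)
  OnlineAlgorithm n =
    Network n → Carrier → List (Request n) → Schedule n → Maybe (Subset n)

  module _ {n : ℕ} (A : OnlineAlgorithm n) (I : Instance n) where
    open Instance I

    transmit : Maybe (Subset n) → Carrier → Schedule n → Schedule n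
    transmit nothing  t past = past
    transmit (just S) t past = (S at t) ∷ past

    runFrom : List (Request n) → Schedule n → Schedule n
    runFrom []       past = past
    runFrom (ρ ∷ ρs) past = runFrom ρs (transmit (A network t arrived past) t past)
      where
      t = deadline ρ
      arrived = filter (λ γ → arrival γ ≤? t) requests

    run : Schedule n
    run = runFrom (sortByDeadline requests) []

  -- Bounding by every feasible schedule is bounding by the optimum.
  CompetitiveOn : ∀ {n ℓ} → (Instance n → Set ℓ) → OnlineAlgorithm n → Carrier →
                  Set (c ⊔ ℓ₁ ⊔ ℓ₂ ⊔ ℓ)
  CompetitiveOn Class A κ = ∀ I → Class I →
    Feasible I (run A I) ×
    (∀ σ → Feasible I σ →
      scheduleCost (network I) (run A I) ≤ κ * scheduleCost (network I) σ)
    where open Instance using (network)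

  module _ {n : ℕ} (N : Network n) where
    open Network N

    -- The loop growing S, with the pending requests listed by deadline. One pass
    -- suffices: S only grows, so a request skipped as satisfied stays satisfied.
    grow : Request n → Subset n → List (Request n) → Subset n
    grow ρ S []       = S
    grow ρ S (γ ∷ γs) =
      if does (node γ ∈? S) then grow ρ S γs
      else if does (costOf S + (costTo node γ given S)
                      ≤? fromℕ 2 * costOf (pathTo (node ρ)))
           then grow ρ (S ∪ pathTo (node γ)) γs
           else S

  Double : ∀ {n} → OnlineAlgorithm n
  Double N t arrived past =
    Maybe.map (λ ρ → grow N ρ (Network.pathTo N (node ρ)) (sortByDeadline pending))
              (head (filter (λ ρ → deadline ρ ≟ t) pending))
    where
    pending = filter (pending? t past) arrived

{-# OPTIONS --safe #-}

-- Write w(v) for the cost of the root–v path. A service of Double triggered by e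
-- costs at most 2 w(e). Suppose a later trigger l had already arrived when e
-- triggered. Then Double stopped at a pending γ with w(γ) > 2 w(e) and a deadline no
-- later than that of l. Either γ = l, or a service in between reached γ but not l; as
-- the tree is a path, w(l) > 2 w(e) in both cases. The triggers served by
-- one service of cost W in another schedule all have arrived before the first of their
-- deadlines, so their path costs form a chain of at most D values, each more than
-- twice the previous one and all at most W. Summing the geometric series gives
-- the bound (4 - 2⁻ᴰ) W on what Double paid for them.
module Submission where

open import Defs
import Algebra.Properties.Ring as RingProperties
import Algebra.Solver.Ring.NaturalCoefficients.Default as SemiringSolver
open import Data.Bool.Base using (if_then_else_)
open import Data.Fin.Base using (Fin; zero; suc; toℕ; fromℕ<)
open import Data.Fin.Properties using (toℕ-injective; toℕ<n; toℕ-fromℕ<)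
open import Data.Fin.Subset using (Subset; inside; outside; _∈_; _∉_; _⊆_; _∪_; _─_; ⋃; ⁅_⁆)
open import Data.Fin.Subset.Properties using (_∈?_; ∉⊥; x∈⁅x⁆; x∈⁅y⁆⇒x≡y; x∈p∪q⁻; p⊆p∪q; q⊆p∪q; drop-∷-⊆)
open import Data.List.Base as List using (List; []; _∷_; filter; foldr; head; map)
open import Data.List.Membership.Propositional using () renaming (_∈_ to _∈ˡ_)
open import Data.List.Membership.Propositional.Properties using (∈-filter⁺; ∈-filter⁻)
open import Data.List.Relation.Binary.Permutation.Propositional using (_↭_; ↭-sym)
open import Data.List.Relation.Binary.Permutation.Propositional.Properties using (∈-resp-↭)
open import Data.List.Relation.Unary.All as All using (All; []; _∷_)
import Data.List.Relation.Unary.All.Properties as All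
open import Data.List.Relation.Unary.AllPairs as AllPairs using (AllPairs; []; _∷_)
import Data.List.Relation.Unary.AllPairs.Properties as AllPairs
open import Data.List.Relation.Unary.Any using (here; there; any?)
open import Data.List.Relation.Unary.Sorted.TotalOrder.Properties using (Sorted⇒AllPairs)
import Data.List.Sort as Sort
open import Data.Maybe.Base as Maybe using (just; nothing)
open import Data.Nat.Base as ℕ using (ℕ; zero; suc)
open import Data.Nat.GeneralisedArithmetic using (iterate)
import Data.Nat.Properties as ℕ
open import Data.Product.Base using (∃; _×_; _,_; proj₁)
open import Data.Sum.Base using (_⊎_; inj₁; inj₂)
open import Data.Vec.Base using (here; []; _∷_)
open import Function.Base using (_∘_; case_of_)
open import Function.Bundles using (Inverse)
open import Level using (_⊔_)
open import Relation.Binary.Bundles using (DecTotalOrder)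
import Relation.Binary.Construct.On as On
import Relation.Binary.Properties.TotalOrder as TotalOrderProperties
import Relation.Binary.Reasoning.PartialOrder as ≤-Reasoning
open import Relation.Binary.PropositionalEquality as ≡ using (_≡_; subst; cong)
open import Relation.Nullary.Decidable using (Dec; does; yes; no; ¬?; decidable-stable)
open import Relation.Nullary.Negation using (¬_; contradiction)

-- Arithmetic in ordered fields and weights of node sets

module OrderedFieldProperties {c ℓ₁ ℓ₂} (K : OrderedField c ℓ₁ ℓ₂) where
  open OrderedField K hiding (zero)
  open DecTotalOrder decTotalOrder public
    using (totalOrder; poset; total)
    renaming (refl to ≤-refl; reflexive to ≤-reflexive; trans to ≤-trans; antisym to ≤-antisym)
  open TotalOrderProperties totalOrder public using (≰⇒≥)
  open RingProperties ring
  open SemiringSolver commutativeSemiring using (solve; con; _:+_; _:*_; _:=_)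
  open ≤-Reasoning poset

  2# 4# : Carrier
  2# = fromℕ 2
  4# = fromℕ 4

  +-mono-≤ : ∀ {u v x y} → u ≤ v → x ≤ y → u + x ≤ v + y
  +-mono-≤ {u} {v} {x} {y} u≤v x≤y = begin
    u + x ≤⟨ +-monoˡ-≤ x u≤v ⟩
    v + x ≈⟨ +-comm v x ⟩
    x + v ≤⟨ +-monoˡ-≤ v x≤y ⟩
    y + v ≈⟨ +-comm y v ⟩
    v + y ∎

  +-nonNeg : ∀ {x y} → 0# ≤ x → 0# ≤ y → 0# ≤ x + y
  +-nonNeg 0≤x 0≤y = ≤-trans (≤-reflexive (sym (+-identityˡ 0#))) (+-mono-≤ 0≤x 0≤y)

  x+y-y≈x : ∀ x y → (x + y) - y ≈ x
  x+y-y≈x x y = trans (+-assoc x y (- y)) (trans (+-congˡ (-‿inverseʳ y)) (+-identityʳ x))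

  x-y+y≈x : ∀ x y → (x - y) + y ≈ x
  x-y+y≈x x y = trans (+-assoc x (- y) y) (trans (+-congˡ (-‿inverseˡ y)) (+-identityʳ x))

  x≤y⇒0≤y-x : ∀ {x y} → x ≤ y → 0# ≤ y - x
  x≤y⇒0≤y-x {x} {y} x≤y = begin
    0#    ≈⟨ -‿inverseʳ x ⟨
    x - x ≤⟨ +-monoˡ-≤ (- x) x≤y ⟩
    y - x ∎

  *-monoʳ-≤-nonNeg : ∀ {x y} z → 0# ≤ z → x ≤ y → z * x ≤ z * y
  *-monoʳ-≤-nonNeg {x} {y} z 0≤z x≤y = begin
    z * x                 ≈⟨ +-identityˡ (z * x) ⟨
    0# + z * x            ≤⟨ +-monoˡ-≤ (z * x) (*-nonNeg 0≤z (x≤y⇒0≤y-x x≤y)) ⟩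
    z * (y - x) + z * x   ≈⟨ distribˡ z (y - x) x ⟨
    z * ((y - x) + x)     ≈⟨ *-congˡ (x-y+y≈x y x) ⟩
    z * y                 ∎

  0≤x*x : ∀ x → 0# ≤ x * x
  0≤x*x x with total 0# x
  ... | inj₁ 0≤x = *-nonNeg 0≤x 0≤x
  ... | inj₂ x≤0 = begin
    0#          ≤⟨ *-nonNeg 0≤-x 0≤-x ⟩
    - x * - x   ≈⟨ -‿distribˡ-* x (- x) ⟨
    - (x * - x) ≈⟨ -‿cong (-‿distribʳ-* x x) ⟨
    - - (x * x) ≈⟨ -‿involutive (x * x) ⟩
    x * x       ∎
    where
    0≤-x : 0# ≤ - x
    0≤-x = ≤-trans (x≤y⇒0≤y-x x≤0) (≤-reflexive (+-identityˡ (- x)))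

  0≤1 : 0# ≤ 1#
  0≤1 = ≤-trans (0≤x*x 1#) (≤-reflexive (*-identityˡ 1#))

  fromℕ-nonNeg : ∀ k → 0# ≤ fromℕ k
  fromℕ-nonNeg zero    = ≤-refl
  fromℕ-nonNeg (suc k) = +-nonNeg 0≤1 (fromℕ-nonNeg k)

  1≤fromℕ-suc : ∀ k → 1# ≤ fromℕ (suc k)
  1≤fromℕ-suc k = begin
    1#           ≈⟨ +-identityʳ 1# ⟨
    1# + 0#      ≤⟨ +-mono-≤ ≤-refl (fromℕ-nonNeg k) ⟩
    1# + fromℕ k ∎

  1≤* : ∀ {x y} → 1# ≤ x → 1# ≤ y → 1# ≤ x * y
  1≤* {x} {y} 1≤x 1≤y = begin
    1#     ≤⟨ 1≤x ⟩
    x      ≈⟨ *-identityʳ x ⟨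
    x * 1# ≤⟨ *-monoʳ-≤-nonNeg x (≤-trans 0≤1 1≤x) 1≤y ⟩
    x * y  ∎

  1≤2^ : ∀ m → 1# ≤ 2# ^ m
  1≤2^ zero    = ≤-refl
  1≤2^ (suc m) = 1≤* (1≤fromℕ-suc 1) (1≤2^ m)

  x≤2*x : ∀ {x} → 0# ≤ x → x ≤ 2# * x
  x≤2*x {x} 0≤x = begin
    x      ≈⟨ +-identityʳ x ⟨
    x + 0# ≤⟨ +-mono-≤ ≤-refl 0≤x ⟩
    x + x  ≈⟨ solve 1 (λ x → x :+ x := (con 1 :+ (con 1 :+ con 0)) :* x) refl x ⟩
    2# * x ∎

  -- The axioms do not order inverses, but `x ⁻¹` equals `x` times the square of `x ⁻¹`.
  ⁻¹-nonNeg : ∀ {x} → 0# ≤ x → ¬ x ≈ 0# → 0# ≤ x ⁻¹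
  ⁻¹-nonNeg {x} 0≤x x≉0 = begin
    0#                  ≤⟨ *-nonNeg 0≤x (0≤x*x (x ⁻¹)) ⟩
    x * (x ⁻¹ * x ⁻¹)   ≈⟨ *-assoc x (x ⁻¹) (x ⁻¹) ⟨
    (x * x ⁻¹) * x ⁻¹   ≈⟨ *-congʳ (⁻¹-inverseʳ x x≉0) ⟩
    1# * x ⁻¹           ≈⟨ *-identityˡ (x ⁻¹) ⟩
    x ⁻¹                ∎

  -- The inequality says z ≤ (q - 1) x, without subtraction.
  slack-mono : ∀ {z q x y} → 1# ≤ q → x ≤ y → z + x ≤ q * x → z + y ≤ q * y
  slack-mono {z} {q} {x} {y} 1≤q x≤y z+x≤qx = begin
    z + y                   ≈⟨ +-congˡ (x-y+y≈x y x) ⟨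
    z + ((y - x) + x)       ≈⟨ solve 3 (λ z d x → z :+ (d :+ x) := (z :+ x) :+ con 1 :* d) refl z (y - x) x ⟩
    (z + x) + 1# * (y - x)  ≤⟨ +-mono-≤ z+x≤qx 1d≤qd ⟩
    q * x + q * (y - x)     ≈⟨ solve 3 (λ q d x → q :* x :+ q :* d := q :* (d :+ x)) refl q (y - x) x ⟩
    q * ((y - x) + x)       ≈⟨ *-congˡ (x-y+y≈x y x) ⟩
    q * y                   ∎
    where
    1d≤qd : 1# * (y - x) ≤ q * (y - x)
    1d≤qd = begin
      1# * (y - x) ≈⟨ *-comm 1# (y - x) ⟩
      (y - x) * 1# ≤⟨ *-monoʳ-≤-nonNeg (y - x) (x≤y⇒0≤y-x x≤y) 1≤q ⟩
      (y - x) * q  ≈⟨ *-comm (y - x) q ⟩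
      q * (y - x)  ∎

  -- The only place where the ratio with its subtraction and inverse is formed, with `p` a power of
  -- two. Until then bounds keep the form `p * z + x ≤ (4# * p) * x`, which can be added up over
  -- services and handled by a semiring solver.
  slack⇒≤ : ∀ {p z x} → 1# ≤ p → p * z + x ≤ (4# * p) * x → z ≤ (4# - p ⁻¹) * x
  slack⇒≤ {p} {z} {x} 1≤p pz+x≤4px = begin
    z                               ≈⟨ x+y-y≈x z (p ⁻¹ * x) ⟨
    (z + p ⁻¹ * x) - p ⁻¹ * x       ≤⟨ +-monoˡ-≤ (- (p ⁻¹ * x)) z+x/p≤4x ⟩
    4# * x - p ⁻¹ * x               ≈⟨ [y-z]x≈yx-zx x 4# (p ⁻¹) ⟨
    (4# - p ⁻¹) * x                 ∎
    where
    0≤p : 0# ≤ p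
    0≤p = ≤-trans 0≤1 1≤p

    p≉0 : ¬ p ≈ 0#
    p≉0 p≈0 = 0≉1 (≤-antisym 0≤1 (≤-trans 1≤p (≤-reflexive p≈0)))

    z+x/p≤4x : z + p ⁻¹ * x ≤ 4# * x
    z+x/p≤4x = begin
      z + p ⁻¹ * x               ≈⟨ +-congʳ (*-identityˡ z) ⟨
      1# * z + p ⁻¹ * x          ≈⟨ +-congʳ (*-congʳ (⁻¹-inverseʳ p p≉0)) ⟨
      (p * p ⁻¹) * z + p ⁻¹ * x  ≈⟨ solve 4 (λ p i z x → (p :* i) :* z :+ i :* x := i :* (p :* z :+ x)) refl p (p ⁻¹) z x ⟩
      p ⁻¹ * (p * z + x)         ≤⟨ *-monoʳ-≤-nonNeg (p ⁻¹) (⁻¹-nonNeg 0≤p p≉0) pz+x≤4px ⟩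
      p ⁻¹ * ((4# * p) * x)      ≈⟨ solve 4 (λ p i f x → i :* ((f :* p) :* x) := (p :* i) :* (f :* x)) refl p (p ⁻¹) 4# x ⟩
      (p * p ⁻¹) * (4# * x)      ≈⟨ *-congʳ (⁻¹-inverseʳ p p≉0) ⟩
      1# * (4# * x)              ≈⟨ *-identityˡ (4# * x) ⟩
      4# * x                     ∎

  -- `costOf` unfolds to `weight cost`. The function is a parameter so that induction on the subset
  -- can pass to `f ∘ suc`.
  weight : ∀ {n} → (Fin n → Carrier) → Subset n → Carrier
  weight f S = sum (λ u → if does (u ∈? S) then f u else 0#)

  -- The left side is the quantity tested by `grow`, so the test compares the cost of the enlarged
  -- set with the budget.
  weight-∪ : ∀ {n} (f : Fin n → Carrier) S P → weight f S + weight f (P ─ S) ≈ weight f (S ∪ P)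
  weight-∪ f []            []            = +-identityˡ 0#
  weight-∪ f (inside  ∷ S) (x       ∷ P) =
    trans (solve 3 (λ a s p → (a :+ s) :+ (con 0 :+ p) := a :+ (s :+ p)) refl _ _ _)
          (+-congˡ (weight-∪ (f ∘ suc) S P))
  weight-∪ f (outside ∷ S) (outside ∷ P) =
    trans (solve 2 (λ s p → (con 0 :+ s) :+ (con 0 :+ p) := con 0 :+ (s :+ p)) refl _ _)
          (+-congˡ (weight-∪ (f ∘ suc) S P))
  weight-∪ f (outside ∷ S) (inside  ∷ P) =
    trans (solve 3 (λ a s p → (con 0 :+ s) :+ (a :+ p) := a :+ (s :+ p)) refl _ _ _)
          (+-congˡ (weight-∪ (f ∘ suc) S P))

  weight-nonNeg : ∀ {n} {f : Fin n → Carrier} → (∀ v → 0# ≤ f v) → ∀ S → 0# ≤ weight f S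
  weight-nonNeg 0≤f []            = ≤-refl
  weight-nonNeg 0≤f (inside  ∷ S) = +-nonNeg (0≤f zero) (weight-nonNeg (0≤f ∘ suc) S)
  weight-nonNeg 0≤f (outside ∷ S) = +-nonNeg ≤-refl (weight-nonNeg (0≤f ∘ suc) S)

  weight-mono : ∀ {n} {f : Fin n → Carrier} → (∀ v → 0# ≤ f v) →
                ∀ S P → S ⊆ P → weight f S ≤ weight f P
  weight-mono 0≤f []            []            S⊆P = ≤-refl
  weight-mono 0≤f (inside  ∷ S) (inside  ∷ P) S⊆P = +-mono-≤ ≤-refl (weight-mono (0≤f ∘ suc) S P (drop-∷-⊆ S⊆P))
  weight-mono 0≤f (inside  ∷ S) (outside ∷ P) S⊆P = case S⊆P here of λ ()
  weight-mono 0≤f (outside ∷ S) (inside  ∷ P) S⊆P = +-mono-≤ (0≤f zero) (weight-mono (0≤f ∘ suc) S P (drop-∷-⊆ S⊆P))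
  weight-mono 0≤f (outside ∷ S) (outside ∷ P) S⊆P = +-mono-≤ ≤-refl (weight-mono (0≤f ∘ suc) S P (drop-∷-⊆ S⊆P))

-- Root paths and subtrees of a rooted tree

∈-⋃-singletons⁺ : ∀ {n} {v : Fin n} vs → v ∈ˡ vs → v ∈ ⋃ (map ⁅_⁆ vs)
∈-⋃-singletons⁺ (u ∷ us) (here ≡.refl) = p⊆p∪q _ (x∈⁅x⁆ u)
∈-⋃-singletons⁺ (u ∷ us) (there v∈us)  = q⊆p∪q ⁅ u ⁆ _ (∈-⋃-singletons⁺ us v∈us)

∈-⋃-singletons⁻ : ∀ {n} {v : Fin n} vs → v ∈ ⋃ (map ⁅_⁆ vs) → v ∈ˡ vs
∈-⋃-singletons⁻ []       v∈ = contradiction v∈ ∉⊥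
∈-⋃-singletons⁻ (u ∷ us) v∈ with x∈p∪q⁻ ⁅ u ⁆ _ v∈
... | inj₁ v∈u  = here (x∈⁅y⁆⇒x≡y u v∈u)
... | inj₂ v∈us = there (∈-⋃-singletons⁻ us v∈us)

module RootedTreeProperties {n} (T : RootedTree n) where
  open RootedTree T
  open IsSubtree

  ∈-pathTo : ∀ v → v ∈ pathTo v
  ∈-pathTo v = ∈-⋃-singletons⁺ (List.iterate parent v (suc (steps v))) (here ≡.refl)

  root∈iterates : ∀ k {v} → iterate parent v k ≡ root → root ∈ˡ List.iterate parent v (suc k)
  root∈iterates zero    v≡root = here (≡.sym v≡root)
  root∈iterates (suc k) p      = there (root∈iterates k p)

  -- The parent of each iterate is the next one in the list; the last iterate is the root, its own
  -- parent.
  iterates-parent-closed : ∀ k {u v} → iterate parent v k ≡ root →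
    u ∈ˡ List.iterate parent v (suc k) → parent u ∈ˡ List.iterate parent v (suc k)
  iterates-parent-closed zero    ≡.refl (here ≡.refl) = here parent-root
  iterates-parent-closed (suc k) p      (here ≡.refl) = there (here ≡.refl)
  iterates-parent-closed (suc k) p      (there u∈)    = there (iterates-parent-closed k p u∈)

  pathTo-subtree : ∀ v → IsSubtree (pathTo v)
  pathTo-subtree v .root∈            = ∈-⋃-singletons⁺ _ (root∈iterates (steps v) (reaches-root v))
  pathTo-subtree v .parent-closed u∈ =
    ∈-⋃-singletons⁺ _ (iterates-parent-closed (steps v) (reaches-root v) (∈-⋃-singletons⁻ _ u∈))

  ∪-subtree : ∀ {S P} → IsSubtree S → IsSubtree P → IsSubtree (S ∪ P)
  ∪-subtree subS subP .root∈ = p⊆p∪q _ (root∈ subS)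
  ∪-subtree {S} {P} subS subP .parent-closed v∈ with x∈p∪q⁻ S P v∈
  ... | inj₁ v∈S = p⊆p∪q _ (parent-closed subS v∈S)
  ... | inj₂ v∈P = q⊆p∪q S P (parent-closed subP v∈P)

-- Depth and subtrees when the tree is a path

module PathProperties {n} {T : RootedTree n} (isPath : IsPath T) where
  open RootedTree T
  open RootedTreeProperties T
  open IsSubtree
  open IsPath isPath
  open Inverse enumeration using (to; from; strictlyInverseˡ; strictlyInverseʳ)

  depth : Fin n → ℕ
  depth v = toℕ (from v)

  depth-injective : ∀ {u v} → depth u ≡ depth v → u ≡ v
  depth-injective {u} {v} eq =
    ≡.trans (≡.sym (strictlyInverseˡ u))
      (≡.trans (cong to (toℕ-injective eq)) (strictlyInverseˡ v))

  depth-parent : ∀ {v k} → depth v ≡ suc k → depth (parent v) ≡ k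
  depth-parent {v} {k} eq = begin
    depth (parent v)               ≡⟨ cong (λ u → depth (parent u)) (strictlyInverseˡ v) ⟨
    depth (parent (to (from v)))   ≡⟨ cong depth (consecutive i (from v) (≡.trans eq (cong suc (≡.sym i≡k)))) ⟩
    depth (to i)                   ≡⟨ cong toℕ (strictlyInverseʳ i) ⟩
    toℕ i                          ≡⟨ i≡k ⟩
    k                              ∎
    where
    open ≡.≡-Reasoning
    k<n : k ℕ.< n
    -- Here `suc k < n` weakens to `suc k ≤ n`, which is `k < n` by definition.
    k<n = ℕ.<⇒≤ (subst (ℕ._< n) eq (toℕ<n (from v)))
    i : Fin n
    i = fromℕ< k<n
    i≡k : toℕ i ≡ k
    i≡k = toℕ-fromℕ< k<n

  depth≡0⇒root : ∀ {v} → depth v ≡ 0 → v ≡ root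
  depth≡0⇒root {v} eq = ≡.trans (≡.sym (strictlyInverseˡ v)) (starts-at-root (from v) eq)

  depth-parent-≤ : ∀ v → depth (parent v) ℕ.≤ depth v
  depth-parent-≤ v = go (depth v) ≡.refl
    where
    go : ∀ k → depth v ≡ k → depth (parent v) ℕ.≤ depth v
    go zero    eq = ℕ.≤-reflexive (cong depth (≡.trans (cong parent v≡root) (≡.trans parent-root (≡.sym v≡root))))
      where
      v≡root : v ≡ root
      v≡root = depth≡0⇒root eq
    go (suc k) eq = ℕ.≤-trans (ℕ.≤-reflexive (depth-parent eq)) (ℕ.≤-trans (ℕ.n≤1+n k) (ℕ.≤-reflexive (≡.sym eq)))

  -- Subtrees of a path are initial segments: climbing from `v` stays in `S`, and after as many
  -- steps as the depths differ it arrives at `u`, since depth determines the node.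
  subtree-initial : ∀ {S u v} → IsSubtree S → v ∈ S → depth u ℕ.≤ depth v → u ∈ S
  subtree-initial {S} {u} subS v∈S u≤v = go _ v∈S (≡.sym (ℕ.m∸n+n≡m u≤v))
    where
    go : ∀ k {v} → v ∈ S → depth v ≡ k ℕ.+ depth u → u ∈ S
    go zero    v∈S eq = subst (_∈ S) (depth-injective eq) v∈S
    go (suc k) v∈S eq = go k (parent-closed subS v∈S) (depth-parent eq)

  ∈-iterates⇒depth-≤ : ∀ k {u v} → u ∈ˡ List.iterate parent v k → depth u ℕ.≤ depth v
  ∈-iterates⇒depth-≤ (suc k) (here ≡.refl) = ℕ.≤-refl
  ∈-iterates⇒depth-≤ (suc k) (there u∈)    = ℕ.≤-trans (∈-iterates⇒depth-≤ k u∈) (depth-parent-≤ _)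

  ∈-pathTo⇒depth-≤ : ∀ {u v} → u ∈ pathTo v → depth u ℕ.≤ depth v
  ∈-pathTo⇒depth-≤ {v = v} u∈ = ∈-iterates⇒depth-≤ (suc (steps v)) (∈-⋃-singletons⁻ _ u∈)

  pathTo-⊆-subtree : ∀ {S v} → IsSubtree S → v ∈ S → pathTo v ⊆ S
  pathTo-⊆-subtree subS v∈S u∈ = subtree-initial subS v∈S (∈-pathTo⇒depth-≤ u∈)

  depth-≤⇒pathTo-⊆ : ∀ {u v} → depth u ℕ.≤ depth v → pathTo u ⊆ pathTo v
  depth-≤⇒pathTo-⊆ {u} {v} u≤v =
    pathTo-⊆-subtree (pathTo-subtree v) (subtree-initial (pathTo-subtree v) (∈-pathTo v) u≤v)

  ∉-subtree⇒depth-< : ∀ {S u v} → IsSubtree S → u ∈ S → v ∉ S → depth u ℕ.< depth v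
  ∉-subtree⇒depth-< subS u∈S v∉S = ℕ.≰⇒> (λ v≤u → v∉S (subtree-initial subS u∈S v≤u))

  -- Makes the test of `grow` at a missing node a test on one path cost: `S ∪ pathTo v` is then no
  -- more than `pathTo v`.
  ∉⇒subtree-⊆-pathTo : ∀ {S v} → IsSubtree S → v ∉ S → S ⊆ pathTo v
  ∉⇒subtree-⊆-pathTo {v = v} subS v∉S u∈S =
    subtree-initial (pathTo-subtree v) (∈-pathTo v) (ℕ.<⇒≤ (∉-subtree⇒depth-< subS u∈S v∉S))

-- Lists with unique or pairwise distinct entries

module _ {a} {A : Set a} where

  head-unique : ∀ {x : A} {xs} → x ∈ˡ xs → (∀ {y} → y ∈ˡ xs → y ≡ x) → head xs ≡ just x
  head-unique {xs = y ∷ ys} _ unique = cong just (unique (here ≡.refl))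

  head-empty : ∀ {xs : List A} → (∀ {y} → ¬ y ∈ˡ xs) → head xs ≡ nothing
  head-empty {[]}     _     = ≡.refl
  head-empty {y ∷ ys} empty = contradiction (here ≡.refl) empty

  AllPairs-strengthen : ∀ {p r s} {P : A → Set p} {R : A → A → Set r} {S : A → A → Set s} →
    (∀ {x y} → P x → P y → R x y → S x y) → ∀ {xs} → All P xs → AllPairs R xs → AllPairs S xs
  AllPairs-strengthen f []         []       = []
  AllPairs-strengthen f (px ∷ pxs) (r ∷ rs) =
    All.zipWith (λ (py , rxy) → f px py rxy) (pxs , r) ∷ AllPairs-strengthen f pxs rs

  -- `AllPairs` compares an entry with later ones only; symmetry covers the opposite order.
  AllPairs-distinct : ∀ {ℓ} {_~_ : A → A → Set ℓ} {xs} → (∀ {x y} → x ~ y → y ~ x) →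
    AllPairs (λ x y → ¬ x ~ y) xs → ∀ {x y} → x ∈ˡ xs → y ∈ˡ xs → x ~ y → x ≡ y
  AllPairs-distinct sym~ (d ∷ ds) (here ≡.refl) (here ≡.refl) x~y = ≡.refl
  AllPairs-distinct sym~ (d ∷ ds) (here ≡.refl) (there y∈)    x~y = contradiction x~y (All.lookup d y∈)
  AllPairs-distinct sym~ (d ∷ ds) (there x∈)    (here ≡.refl) x~y = contradiction (sym~ x~y) (All.lookup d x∈)
  AllPairs-distinct sym~ (d ∷ ds) (there x∈)    (there y∈)    x~y = AllPairs-distinct sym~ ds x∈ y∈ x~y

-- Path costs and the relation between triggers

module DoubleOnPath {c ℓ₁ ℓ₂} (K : OrderedField c ℓ₁ ℓ₂) {n : ℕ} (I : MLAPD.Instance K n)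
                    (isPath : IsPath (MLAPD.Instance.tree I)) where
  open OrderedField K hiding (zero)
  open OrderedFieldProperties K
  open MLAPD K
  open Instance I
  open RootedTreeProperties tree
  open PathProperties isPath
  open SemiringSolver commutativeSemiring using (Polynomial; solve; con; _:+_; _:*_; _:=_)
  open ≤-Reasoning poset

  cost-nonNeg : ∀ v → 0# ≤ cost v
  cost-nonNeg v = proj₁ (cost-pos v)

  costOf-nonNeg : ∀ S → 0# ≤ costOf S
  costOf-nonNeg = weight-nonNeg cost-nonNeg

  costOf-mono : ∀ {S P} → S ⊆ P → costOf S ≤ costOf P
  costOf-mono {S} {P} = weight-mono cost-nonNeg S P

  pathCost : Request n → Carrier
  pathCost ρ = costOf (pathTo (node ρ))

  -- A strict inequality, phrased as the refutation that a failed `≤?` provides; totality turns it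
  -- into `2# * pathCost ρ ≤ pathCost γ` where needed.
  Outweighs : Request n → Request n → Set ℓ₂
  Outweighs γ ρ = ¬ pathCost γ ≤ 2# * pathCost ρ

  outweighs⇒depth-< : ∀ γ ρ → Outweighs γ ρ → depth (node ρ) ℕ.< depth (node γ)
  outweighs⇒depth-< γ ρ γ>ρ = ℕ.≰⇒> λ γ≤ρ → γ>ρ (begin
    pathCost γ       ≤⟨ costOf-mono (depth-≤⇒pathTo-⊆ γ≤ρ) ⟩
    pathCost ρ       ≤⟨ x≤2*x (costOf-nonNeg _) ⟩
    2# * pathCost ρ  ∎)

  -- Each step along a chain uses up at least one level of depth, so the depth bound can drive the
  -- recursion in the geometric sum.
  outweighed-depth : ∀ {m τ} ρ → depth (node ρ) ℕ.< suc m → All (Outweighs ρ) τ →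
                     All (λ e → depth (node e) ℕ.< m) τ
  outweighed-depth ρ ρ<1+m =
    All.map λ {e} ρ>e → ℕ.<-≤-trans (outweighs⇒depth-< ρ e ρ>e) (ℕ.s≤s⁻¹ ρ<1+m)

  -- `S` is an initial segment containing `γ` but not `l`, so `l` lies deeper and its path costs at
  -- least as much.
  outweighs-beyond : ∀ {S} γ l ρ → IsSubtree S → node γ ∈ S → node l ∉ S →
                     Outweighs γ ρ → Outweighs l ρ
  outweighs-beyond γ l ρ subS γ∈S l∉S γ>ρ l≤ρ =
    γ>ρ (≤-trans (costOf-mono (depth-≤⇒pathTo-⊆ (ℕ.<⇒≤ (∉-subtree⇒depth-< subS γ∈S l∉S)))) l≤ρ)

  -- The loop that grows a service

  grow-⊇ : ∀ ρ S γs → S ⊆ grow network ρ S γs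
  grow-⊇ ρ S []       v∈S = v∈S
  grow-⊇ ρ S (γ ∷ γs) v∈S with node γ ∈? S
  ... | yes _ = grow-⊇ ρ S γs v∈S
  ... | no  _ with costOf S + (costTo node γ given S) ≤? 2# * pathCost ρ
  ...   | yes _ = grow-⊇ ρ (S ∪ pathTo (node γ)) γs (p⊆p∪q _ v∈S)
  ...   | no  _ = v∈S

  grow-subtree : ∀ ρ {S} γs → IsSubtree S → IsSubtree (grow network ρ S γs)
  grow-subtree ρ     []       subS = subS
  grow-subtree ρ {S} (γ ∷ γs) subS with node γ ∈? S
  ... | yes _ = grow-subtree ρ γs subS
  ... | no  _ with costOf S + (costTo node γ given S) ≤? 2# * pathCost ρ
  ...   | yes _ = grow-subtree ρ γs (∪-subtree subS (pathTo-subtree (node γ)))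
  ...   | no  _ = subS

  grow-cost : ∀ ρ {S} γs → costOf S ≤ 2# * pathCost ρ → costOf (grow network ρ S γs) ≤ 2# * pathCost ρ
  grow-cost ρ     []       S≤ = S≤
  grow-cost ρ {S} (γ ∷ γs) S≤ with node γ ∈? S
  ... | yes _ = grow-cost ρ γs S≤
  ... | no  _ with costOf S + (costTo node γ given S) ≤? 2# * pathCost ρ
  ...   | yes fits = grow-cost ρ γs (≤-trans (≤-reflexive (sym (weight-∪ cost S (pathTo (node γ))))) fits)
  ...   | no  _    = S≤

  -- The blocker is the request at which the loop stops. If `l` was not reached before that,
  -- sortedness puts its deadline no earlier than the blocker's.
  grow-blocked : ∀ ρ {S} γs → IsSubtree S → AllPairs (λ γ l → deadline γ ≤ deadline l) γs →
    ∀ {l} → l ∈ˡ γs → node l ∈ grow network ρ S γs ⊎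
      ∃ λ γ → γ ∈ˡ γs × deadline γ ≤ deadline l × Outweighs γ ρ × node γ ∉ grow network ρ S γs
  grow-blocked ρ {S} (γ ∷ γs) subS (γ≤ ∷ sorted) l∈ with node γ ∈? S
  ... | yes γ∈S = case l∈ of λ where
          (here ≡.refl) → inj₁ (grow-⊇ ρ S γs γ∈S)
          (there l∈γs)  → case grow-blocked ρ γs subS sorted l∈γs of λ where
            (inj₁ l∈S)           → inj₁ l∈S
            (inj₂ (β , β∈ , bs)) → inj₂ (β , there β∈ , bs)
  ... | no γ∉S with costOf S + (costTo node γ given S) ≤? 2# * pathCost ρ
  ...   | yes _ = case l∈ of λ where
            (here ≡.refl) → inj₁ (grow-⊇ ρ _ γs (q⊆p∪q S _ (∈-pathTo (node γ))))
            (there l∈γs)  → case grow-blocked ρ γs (∪-subtree subS (pathTo-subtree (node γ))) sorted l∈γs of λ where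
              (inj₁ l∈S)           → inj₁ l∈S
              (inj₂ (β , β∈ , bs)) → inj₂ (β , there β∈ , bs)
  -- The loop returns `S` unchanged here, so `γ∉S` already speaks of the final set.
  ...   | no exceeds = inj₂ (γ , here ≡.refl , γ≤l l∈ , γ>ρ , γ∉S)
    where
    γ≤l : ∀ {l} → l ∈ˡ γ ∷ γs → deadline γ ≤ deadline l
    γ≤l (here ≡.refl) = ≤-refl
    γ≤l (there l∈γs)  = All.lookup γ≤ l∈γs

    ∪⊆pathTo : S ∪ pathTo (node γ) ⊆ pathTo (node γ)
    ∪⊆pathTo v∈ with x∈p∪q⁻ S (pathTo (node γ)) v∈
    ... | inj₁ v∈S = ∉⇒subtree-⊆-pathTo subS γ∉S v∈S
    ... | inj₂ v∈P = v∈P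

    γ>ρ : Outweighs γ ρ
    γ>ρ γ≤ρ = exceeds (begin
      costOf S + (costTo node γ given S) ≈⟨ weight-∪ cost S (pathTo (node γ)) ⟩
      costOf (S ∪ pathTo (node γ))       ≤⟨ costOf-mono ∪⊆pathTo ⟩
      pathCost γ                         ≤⟨ γ≤ρ ⟩
      2# * pathCost ρ                    ∎)

  -- The geometric series along a chain

  -- Stands in for what `Double` paid: each service costs at most twice the path cost of its
  -- trigger, by `growth-cost`.
  doubledCost : List (Request n) → Carrier
  doubledCost = foldr (λ ρ total → 2# * pathCost ρ + total) 0#

  1≤4*2^ : ∀ m → 1# ≤ 4# * 2# ^ m
  1≤4*2^ m = 1≤* (1≤fromℕ-suc 3) (1≤2^ m)

  -- Write w for `pathCost ρ`. The hypothesis bounds the tail by (2 - 2^(-m-1)) w; the payment 2 w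
  -- for `ρ` itself raises this to (4 - 2^(-m-1)) w.
  head-bound : ∀ m ρ τ →
    (2# ^ suc m) * doubledCost τ + pathCost ρ ≤ (4# * 2# ^ m) * pathCost ρ →
    (2# ^ suc m) * doubledCost (ρ ∷ τ) + pathCost ρ ≤ (4# * 2# ^ suc m) * pathCost ρ
  head-bound m ρ τ bound = begin
    (2# * P) * (2# * w + z) + w              ≈⟨ solve 3 (λ P w z → (two :* P) :* (two :* w :+ z) :+ w
                                                  := ((two :* P) :* z :+ w) :+ (four :* P) :* w) refl P w z ⟩
    ((2# * P) * z + w) + (4# * P) * w        ≤⟨ +-monoˡ-≤ ((4# * P) * w) bound ⟩
    (4# * P) * w + (4# * P) * w              ≈⟨ solve 2 (λ P w → (four :* P) :* w :+ (four :* P) :* w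
                                                  := (four :* (two :* P)) :* w) refl P w ⟩
    (4# * (2# * P)) * w                      ∎
    where
    P w z : Carrier
    P = 2# ^ m
    w = pathCost ρ
    z = doubledCost τ
    two four : ∀ {k} → Polynomial k
    two  = con 1 :+ (con 1 :+ con 0)
    four = con 1 :+ (con 1 :+ two)

  -- Both sides vanish at 0, and `slack-mono` carries the inequality up to `x`.
  empty-bound : ∀ p m {x} → 0# ≤ x → p * doubledCost [] + x ≤ (4# * 2# ^ m) * x
  empty-bound p m 0≤x = slack-mono (1≤4*2^ m) 0≤x
    (≤-reflexive (trans (+-identityʳ (p * 0#)) (trans (zeroʳ p) (sym (zeroʳ (4# * 2# ^ m))))))

  -- Halving the room for the rest of the chain costs one level of depth.
  tail-bound : ∀ m {x} τ → 0# ≤ x → AllPairs Outweighs τ → All (λ ρ → depth (node ρ) ℕ.< m) τ →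
    All (λ ρ → 2# * pathCost ρ ≤ x) τ → (2# ^ suc m) * doubledCost τ + x ≤ (4# * 2# ^ m) * x
  tail-bound m       []      0≤x _ _ _ = empty-bound (2# ^ suc m) m 0≤x
  tail-bound (suc m) (ρ ∷ τ) 0≤x (>τ ∷ chain) (ρ<m ∷ _) (2ρ≤x ∷ _) =
    slack-mono (1≤4*2^ (suc m)) 2ρ≤x (begin
      (2# * Q) * z + 2# * w  ≈⟨ solve 4 (λ t Q z w → (t :* Q) :* z :+ t :* w := t :* (Q :* z :+ w)) refl 2# Q z w ⟩
      2# * (Q * z + w)       ≤⟨ *-monoʳ-≤-nonNeg 2# (fromℕ-nonNeg 2) (head-bound m ρ τ bound) ⟩
      2# * ((4# * Q) * w)    ≈⟨ solve 4 (λ t f Q w → t :* ((f :* Q) :* w) := (f :* Q) :* (t :* w)) refl 2# 4# Q w ⟩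
      (4# * Q) * (2# * w)    ∎)
    where
    Q w z : Carrier
    Q = 2# ^ suc m
    w = pathCost ρ
    z = doubledCost (ρ ∷ τ)

    bound : (2# ^ suc m) * doubledCost τ + w ≤ (4# * 2# ^ m) * w
    bound = tail-bound m τ (costOf-nonNeg _) chain
      (outweighed-depth ρ ρ<m >τ)
      (All.map ≰⇒≥ >τ)

  -- In ratio form the bound is (4 - 2^(-m)) x. The first trigger need only fit into `x` itself,
  -- whereas each later one fits twice into the path cost of its predecessor; hence the head is
  -- treated apart from `tail-bound`, whose ratio is 2 - 2^(-m-1).
  chain-bound : ∀ m {x} τ → 0# ≤ x → AllPairs Outweighs τ → All (λ ρ → depth (node ρ) ℕ.< m) τ →
    All (λ ρ → pathCost ρ ≤ x) τ → (2# ^ m) * doubledCost τ + x ≤ (4# * 2# ^ m) * x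
  chain-bound m       []      0≤x _ _ _ = empty-bound (2# ^ m) m 0≤x
  chain-bound (suc m) (ρ ∷ τ) 0≤x (>τ ∷ chain) (ρ<m ∷ _) (ρ≤x ∷ _) =
    slack-mono (1≤4*2^ (suc m)) ρ≤x (head-bound m ρ τ (tail-bound m τ (costOf-nonNeg _) chain
      (outweighed-depth ρ ρ<m >τ)
      (All.map ≰⇒≥ >τ)))

  -- Charging triggers to services, and blocked requests

  doubledCost-filter : ∀ {p} {P : Request n → Set p} (P? : ∀ ρ → Dec (P ρ)) τ →
    doubledCost τ ≈ doubledCost (filter P? τ) + doubledCost (filter (¬? ∘ P?) τ)
  doubledCost-filter P? []      = sym (+-identityʳ 0#)
  doubledCost-filter P? (ρ ∷ τ) with P? ρ
  ... | yes _ = trans (+-congˡ (doubledCost-filter P? τ)) (sym (+-assoc _ _ _))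
  ... | no  _ = trans (+-congˡ (doubledCost-filter P? τ))
                  (solve 3 (λ w x y → w :+ (x :+ y) := x :+ (w :+ y)) refl _ _ _)

  -- Triggers are listed latest first, so `l` is the later one. The arrival condition holds whenever
  -- one service satisfies both, its time lying between the arrival of `l` and the deadline of `e`.
  Chained : Request n → Request n → Set ℓ₂
  Chained l e = arrival l ≤ deadline e → Outweighs l e

  service-bound : ∀ s τ → IsSubtree (nodes s) → AllPairs Chained τ → All (Satisfies s) τ →
    (2# ^ n) * doubledCost τ + costOf (nodes s) ≤ (4# * 2# ^ n) * costOf (nodes s)
  service-bound s τ subS chained satisfied = chain-bound n τ (costOf-nonNeg _)
    (AllPairs-strengthen (λ (_ , a≤t , _) (_ , _ , t≤d) ch → ch (≤-trans a≤t t≤d)) satisfied chained)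
    -- Depths start at 0 for the root, so all lie below the number of nodes.
    (All.universal (λ ρ → toℕ<n _) τ)
    (All.map (λ (v∈S , _) → costOf-mono (pathTo-⊆-subtree subS v∈S)) satisfied)

  -- Each trigger is charged to the first listed service that satisfies it. Sublists of a chained
  -- list are chained, so `service-bound` applies to every share and the bounds add up.
  schedule-bound : ∀ σ τ → All (λ s → IsSubtree (nodes s)) σ → AllPairs Chained τ → All (SatisfiedBy σ) τ →
    (2# ^ n) * doubledCost τ + scheduleCost network σ ≤ (4# * 2# ^ n) * scheduleCost network σ
  schedule-bound []      []      _ _ _        = empty-bound (2# ^ n) n ≤-refl
  schedule-bound []      (_ ∷ _) _ _ (() ∷ _)
  schedule-bound (s ∷ σ) τ (subS ∷ subs) chained satisfied = begin
    E * doubledCost τ + (cs + cσ)    ≈⟨ +-congʳ (*-congˡ (doubledCost-filter (satisfies? s) τ)) ⟩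
    E * (z₁ + z₂) + (cs + cσ)        ≈⟨ solve 5 (λ E z₁ z₂ cs cσ → E :* (z₁ :+ z₂) :+ (cs :+ cσ)
                                           := (E :* z₁ :+ cs) :+ (E :* z₂ :+ cσ)) refl E z₁ z₂ cs cσ ⟩
    (E * z₁ + cs) + (E * z₂ + cσ)    ≤⟨ +-mono-≤ byService byOthers ⟩
    (4# * E) * cs + (4# * E) * cσ    ≈⟨ distribˡ (4# * E) cs cσ ⟨
    (4# * E) * (cs + cσ)             ∎
    where
    τ₁ τ₂ : List (Request n)
    τ₁ = filter (satisfies? s) τ
    τ₂ = filter (¬? ∘ satisfies? s) τ
    E z₁ z₂ cs cσ : Carrier
    E  = 2# ^ n
    z₁ = doubledCost τ₁
    z₂ = doubledCost τ₂
    cs = costOf (nodes s)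
    cσ = scheduleCost network σ

    byService : E * z₁ + cs ≤ (4# * E) * cs
    byService = service-bound s τ₁ subS (AllPairs.filter⁺ (satisfies? s) chained)
                  (All.all-filter (satisfies? s) τ)

    byRest : ∀ ρ → (¬ Satisfies s ρ) × SatisfiedBy (s ∷ σ) ρ → SatisfiedBy σ ρ
    byRest ρ (¬sat , here sat)  = contradiction sat ¬sat
    byRest ρ (_    , there sat) = sat

    byOthers : E * z₂ + cσ ≤ (4# * E) * cσ
    byOthers = schedule-bound σ τ₂ subs (AllPairs.filter⁺ (¬? ∘ satisfies? s) chained)
                 (All.zipWith (λ {ρ} → byRest ρ)
                   (All.all-filter (¬? ∘ satisfies? s) τ , All.filter⁺ (¬? ∘ satisfies? s) satisfied))

  -- Once γ is served before l, the serving subtree stops short of l, so l itself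
  -- outweighs e; hence the property survives later services.
  Blocked : Schedule n → Request n → Set _
  Blocked past e = ∀ l → l ∈ˡ requests → ¬ SatisfiedBy past l → arrival l ≤ deadline e →
    Outweighs l e ⊎
    ∃ λ γ → γ ∈ˡ requests × ¬ SatisfiedBy past γ × deadline γ ≤ deadline l × Outweighs γ e

  blocked-transmit : ∀ {past S t} e → IsSubtree S → deadline e ≤ t → Blocked past e →
                     Blocked ((S at t) ∷ past) e
  blocked-transmit {S = S} {t} e subS e≤t blocked l l∈ l-unsat l≤e
    with blocked l l∈ (l-unsat ∘ there) l≤e
  ... | inj₁ l>e = inj₁ l>e
  ... | inj₂ (γ , γ∈ , γ-unsat , γ≤l , γ>e) with satisfies? (S at t) γ
  ...   | yes (γ∈S , _ , t≤γ) =
            inj₁ (outweighs-beyond γ l e subS γ∈S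
              -- Containing `l` would mean satisfying it: its arrival is at most `deadline e`, hence
              -- at most `t`, and `t` is at most the deadline of `γ`, hence of `l`.
              (λ l∈S → l-unsat (here (l∈S , ≤-trans l≤e e≤t , ≤-trans t≤γ γ≤l))) γ>e)
  ...   | no γ-missed =
            inj₂ (γ , γ∈ , (λ where (here sat) → γ-missed sat ; (there sat) → γ-unsat sat) , γ≤l , γ>e)

  -- A single decision of Double at a deadline

  sortByDeadline-sorted : ∀ ρs → AllPairs (λ γ l → deadline γ ≤ deadline l) (sortByDeadline {n} ρs)
  sortByDeadline-sorted ρs = Sorted⇒AllPairs (DecTotalOrder.totalOrder byDeadline) (Sort.sort-↗ byDeadline ρs)
    where byDeadline = On.decTotalOrder decTotalOrder deadline

  sortByDeadline-↭ : ∀ ρs → sortByDeadline {n} ρs ↭ ρs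
  sortByDeadline-↭ = Sort.sort-↭ (On.decTotalOrder decTotalOrder deadline)

  same-deadline : ∀ {ρ γ} → ρ ∈ˡ requests → γ ∈ˡ requests → deadline ρ ≈ deadline γ → ρ ≡ γ
  same-deadline = AllPairs-distinct sym distinct-deadlines

  satisfied? : ∀ past (ρ : Request n) → Dec (SatisfiedBy past ρ)
  satisfied? past ρ = any? (λ s → satisfies? s ρ) past

  module _ (past : Schedule n) (ρ : Request n) (ρ∈ : ρ ∈ˡ requests) where
    arrived pending : List (Request n)
    arrived = filter (λ γ → arrival γ ≤? deadline ρ) requests
    pending = filter (pending? (deadline ρ) past) arrived

    growth : Subset n
    growth = grow network ρ (pathTo (node ρ)) (sortByDeadline pending)

    ∈-pending⁺ : ∀ {γ} → γ ∈ˡ requests → arrival γ ≤ deadline ρ → ¬ SatisfiedBy past γ → γ ∈ˡ pending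
    ∈-pending⁺ γ∈ a≤ unsat =
      ∈-filter⁺ (pending? (deadline ρ) past) (∈-filter⁺ (λ γ → arrival γ ≤? deadline ρ) γ∈ a≤) (a≤ , unsat)

    ∈-pending⁻ : ∀ {γ} → γ ∈ˡ pending → γ ∈ˡ requests × ¬ SatisfiedBy past γ
    ∈-pending⁻ γ∈ with ∈-filter⁻ (pending? (deadline ρ) past) {xs = arrived} γ∈
    ... | γ∈arrived , _ , unsat =
          proj₁ (∈-filter⁻ (λ γ → arrival γ ≤? deadline ρ) {xs = requests} γ∈arrived) , unsat

    -- Distinct deadlines leave `ρ` as the only request that can be due, which settles the `head`
    -- that `Double` takes.
    due-unique : ∀ {γ} → γ ∈ˡ filter (λ γ → deadline γ ≟ deadline ρ) pending →
                 γ ≡ ρ × ¬ SatisfiedBy past γ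
    due-unique γ∈ with ∈-filter⁻ (λ γ → deadline γ ≟ deadline ρ) {xs = pending} γ∈
    ... | γ∈pending , d≈ with ∈-pending⁻ γ∈pending
    ...   | γ∈requests , unsat = same-deadline γ∈requests ρ∈ d≈ , unsat

    Double-idle : SatisfiedBy past ρ → Double network (deadline ρ) arrived past ≡ nothing
    Double-idle sat = cong (Maybe.map _) (head-empty λ γ∈ → case due-unique γ∈ of λ where
      (≡.refl , unsat) → unsat sat)

    Double-transmits : ¬ SatisfiedBy past ρ → Double network (deadline ρ) arrived past ≡ just growth
    Double-transmits unsat = cong (Maybe.map _) (head-unique
      (∈-filter⁺ (λ γ → deadline γ ≟ deadline ρ) (∈-pending⁺ ρ∈ (arrival≤deadline ρ) unsat) refl)
      (proj₁ ∘ due-unique))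

    growth-subtree : IsSubtree growth
    growth-subtree = grow-subtree ρ (sortByDeadline pending) (pathTo-subtree (node ρ))

    growth-cost : costOf growth ≤ 2# * pathCost ρ
    growth-cost = grow-cost ρ (sortByDeadline pending) (x≤2*x (costOf-nonNeg _))

    growth-satisfies : Satisfies (growth at deadline ρ) ρ
    growth-satisfies = grow-⊇ ρ _ (sortByDeadline pending) (∈-pathTo (node ρ)) , arrival≤deadline ρ , ≤-refl

    -- An absorbed pending `l` would be satisfied, as its deadline has not passed. So `l` was cut
    -- off, and the blocker, missed by this service too, remains unsatisfied.
    growth-blocked : (∀ {l} → l ∈ˡ requests → ¬ SatisfiedBy past l → deadline ρ ≤ deadline l) →
                     Blocked ((growth at deadline ρ) ∷ past) ρ
    growth-blocked not-overdue l l∈ l-unsat l≤ρ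
      with grow-blocked ρ (sortByDeadline pending) (pathTo-subtree (node ρ)) (sortByDeadline-sorted pending)
             (∈-resp-↭ (↭-sym (sortByDeadline-↭ pending)) (∈-pending⁺ l∈ l≤ρ (l-unsat ∘ there)))
    ... | inj₁ l∈S = contradiction (here (l∈S , l≤ρ , not-overdue l∈ (l-unsat ∘ there))) l-unsat
    ... | inj₂ (γ , γ∈sorted , γ≤l , γ>ρ , γ∉S) with ∈-pending⁻ (∈-resp-↭ (sortByDeadline-↭ pending) γ∈sorted)
    ...   | γ∈ , γ-unsat =
              inj₂ (γ , γ∈ , (λ where (here (γ∈S , _)) → γ∉S γ∈S ; (there sat) → γ-unsat sat) , γ≤l , γ>ρ)

  -- The invariant of the run

  -- `unsatisfied` says that no request expires and becomes feasibility once nothing remains.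
  -- `past-due` lets `blocked` survive a later service, and `blocked` is what extends `chained` at
  -- the next trigger.
  record Invariant (remaining : List (Request n)) (past : Schedule n) : Set (c ⊔ ℓ₁ ⊔ ℓ₂) where
    field
      subtrees    : All (λ s → IsSubtree (nodes s)) past
      unsatisfied : ∀ {l} → l ∈ˡ requests → ¬ SatisfiedBy past l → l ∈ˡ remaining
      triggers    : List (Request n)
      requested   : All (_∈ˡ requests) triggers
      past-due    : All (λ e → All (λ l → deadline e ≤ deadline l) remaining) triggers
      blocked     : All (Blocked past) triggers
      chained     : AllPairs Chained triggers
      cost-bound  : scheduleCost network past ≤ doubledCost triggers
  open Invariant

  idle-invariant : ∀ {ρ ρs past} → SatisfiedBy past ρ → Invariant (ρ ∷ ρs) past → Invariant ρs past
  idle-invariant sat inv = record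
    { subtrees    = subtrees inv
    ; unsatisfied = λ l∈ unsat → case unsatisfied inv l∈ unsat of λ where
        (here ≡.refl) → contradiction sat unsat
        (there l∈ρs)  → l∈ρs
    ; triggers    = triggers inv
    ; requested   = requested inv
    ; past-due    = All.map All.tail (past-due inv)
    ; blocked     = blocked inv
    ; chained     = chained inv
    ; cost-bound  = cost-bound inv
    }

  transmit-invariant : ∀ {ρ ρs past} (ρ∈ : ρ ∈ˡ requests) → All (λ l → deadline ρ ≤ deadline l) ρs →
    ¬ SatisfiedBy past ρ → Invariant (ρ ∷ ρs) past →
    Invariant ρs ((growth past ρ ρ∈ at deadline ρ) ∷ past)
  transmit-invariant {ρ} {ρs} {past} ρ∈ ρ≤ρs ρ-unsat inv = record
    { subtrees    = growth-subtree past ρ ρ∈ ∷ subtrees inv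
    ; unsatisfied = λ l∈ unsat → case unsatisfied inv l∈ (unsat ∘ there) of λ where
        (here ≡.refl) → contradiction (here (growth-satisfies past ρ ρ∈)) unsat
        (there l∈ρs)  → l∈ρs
    ; triggers    = ρ ∷ triggers inv
    ; requested   = ρ∈ ∷ requested inv
    ; past-due    = ρ≤ρs ∷ All.map All.tail (past-due inv)
    ; blocked     = growth-blocked past ρ ρ∈ not-overdue
                  ∷ All.zipWith (λ {e} (due , blk) →
                                   blocked-transmit e (growth-subtree past ρ ρ∈) (All.head due) blk)
                                (past-due inv , blocked inv)
    ; chained     = All.map (λ {e} → chains e) (blocked inv) ∷ chained inv
    ; cost-bound  = +-mono-≤ (growth-cost past ρ ρ∈) (cost-bound inv)
    }
    where
    not-overdue : ∀ {l} → l ∈ˡ requests → ¬ SatisfiedBy past l → deadline ρ ≤ deadline l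
    not-overdue l∈ unsat = All.lookup (≤-refl ∷ ρ≤ρs) (unsatisfied inv l∈ unsat)

    chains : ∀ e → Blocked past e → Chained ρ e
    chains e blk ρ≤e with blk ρ ρ∈ ρ-unsat ρ≤e
    ... | inj₁ ρ>e = ρ>e
    -- No unsatisfied request has a deadline before that of `ρ`, so the blocker shares its deadline
    -- and, deadlines being distinct, is `ρ` itself.
    ... | inj₂ (γ , γ∈ , γ-unsat , γ≤ρ , γ>e) =
          subst (λ γ → Outweighs γ e) (same-deadline γ∈ ρ∈ (≤-antisym γ≤ρ (not-overdue γ∈ γ-unsat))) γ>e

  runFrom-invariant : ∀ {ρs past} → AllPairs (λ γ l → deadline γ ≤ deadline l) ρs →
    All (_∈ˡ requests) ρs → Invariant ρs past → Invariant [] (runFrom Double I ρs past)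
  runFrom-invariant {[]} _ _ inv = inv
  runFrom-invariant {ρ ∷ ρs} {past} (ρ≤ρs ∷ sorted) (ρ∈ ∷ ρs∈) inv with satisfied? past ρ
  ... | yes sat rewrite Double-idle past ρ ρ∈ sat =
        runFrom-invariant sorted ρs∈ (idle-invariant sat inv)
  ... | no unsat rewrite Double-transmits past ρ ρ∈ unsat =
        runFrom-invariant sorted ρs∈ (transmit-invariant ρ∈ ρ≤ρs unsat inv)

  run-invariant : Invariant [] (run Double I)
  run-invariant = runFrom-invariant (sortByDeadline-sorted requests)
    (All.tabulate (∈-resp-↭ (sortByDeadline-↭ requests)))
    record
      { subtrees    = []
      ; unsatisfied = λ l∈ _ → ∈-resp-↭ (↭-sym (sortByDeadline-↭ requests)) l∈
      ; triggers    = []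
      ; requested   = []
      ; past-due    = []
      ; blocked     = []
      ; chained     = []
      ; cost-bound  = ≤-refl
      }

  -- Feasibility and the competitive ratio

  Double-feasible : Feasible I (run Double I)
  Double-feasible = record
    { subtrees  = subtrees run-invariant
    ; satisfied = All.tabulate λ {ρ} ρ∈ →
        -- An unsatisfied request would lie in the empty list of remaining ones; decidability turns
        -- this refutation into satisfaction.
        decidable-stable (satisfied? (run Double I) ρ) λ unsat →
          case unsatisfied run-invariant ρ∈ unsat of λ ()
    }

  -- Triggers are requests, so `σ` satisfies them all and `schedule-bound` applies; `slack⇒≤` then
  -- divides by `2# ^ n`.
  Double-bound : ∀ σ → Feasible I σ →
    scheduleCost network (run Double I) ≤ (4# - (2# ^ n) ⁻¹) * scheduleCost network σ
  Double-bound σ feasible = ≤-trans (cost-bound run-invariant)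
    (slack⇒≤ (1≤2^ n)
      (schedule-bound σ (triggers run-invariant) (Feasible.subtrees feasible) (chained run-invariant)
        (All.map (All.lookup (Feasible.satisfied feasible)) (requested run-invariant))))

mainTheorem3 : ∀ {c ℓ₁ ℓ₂} (K : OrderedField c ℓ₁ ℓ₂) (D : ℕ) →
    let open OrderedField K
        open MLAPD K
    in CompetitiveOn {D} (λ I → IsPath (Instance.tree I)) Double
         (fromℕ 4 - (fromℕ 2 ^ D) ⁻¹)
mainTheorem3 K D I isPath = Double-feasible , Double-bound
  where open DoubleOnPath K I isPath
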